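{- Let $n\ge 3$ be an integer and let $C_n$ be the cycle with $n$ vertices. Then \[ \Theta(C_n)=\begin{cases} 1 & \text{if } n=3,\\ 2 & \text{if } n=4,\\ 4 & \text{if } n\ge 5.\end{cases}\]
   Context: All graphs are finite and simple. Let $k$ be a positive integer. A graph $G=(V,E)$ is a $k$-threshold graph with thresholds $\theta_1<\theta_2<\dots<\theta_k$ (real numbers) if there is a map $r:V\to\mathbb{R}$ such that for all distinct $u,v\in V$: $uv\in E$ if and only if the inequality $\theta_i\le r(u)+r(v)$ holds for an odd number of indices $i\in\{1,\dots,k\}$. Such a map $r$ is called a $(\theta_1,\dots,\theta_k)$-representation of $G$. The threshold number $\Theta(G)$ is the smallest positive integer $k$ such that $G$ is a $k$-threshold graph (for some choice of thresholds $\theta_1<\dots<\theta_k$). -}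

module Defs where

open import Data.Fin as Fin using (Fin; toℕ)
open import Data.Fin.Subset using (Subset; _∈_; ∣_∣)
open import Data.Nat as ℕ using (ℕ; suc; _%_)
import Data.Nat.Properties as ℕ
open import Data.Product using (Σ-syntax; ∃-syntax; _×_; _,_)
open import Data.Rational as ℚ using (ℚ; 0ℚ; ½)
import Data.Rational.Properties as ℚ
open import Data.Rational.Solver using (module +-*-Solver)
open import Data.Sum using (_⊎_; inj₁; inj₂; swap)
open import Function.Bundles using (_⇔_)
open import Level using (0ℓ)
open import Relation.Binary.Core using (Rel)
open import Relation.Binary.Definitions using (Decidable; Symmetric)
open import Relation.Binary.PropositionalEquality
  using (_≡_; _≢_; refl; sym; trans; cong; subst)
open import Relation.Nullary.Decidable using (_×-dec_; _⊎-dec_)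
open import Relation.Nullary.Negation using (¬_)

-- Real numbers as Cauchy sequences of rationals.  Two sequences denote the
-- same real when each is _≤ᴿ_ the other; _+ᴿ_, _≤ᴿ_ and _<ᴿ_ respect this.

Cauchy : (ℕ → ℚ) → Set
Cauchy x = ∀ ε → 0ℚ ℚ.< ε →
  ∃[ N ] (∀ m n → N ℕ.≤ m → N ℕ.≤ n → ℚ.∣ x m ℚ.- x n ∣ ℚ.< ε)

record ℝ : Set where
  constructor mkℝ
  field
    seq    : ℕ → ℚ
    cauchy : Cauchy seq

open ℝ public

infix 4 _≤ᴿ_ _<ᴿ_
infixl 6 _+ᴿ_

_≤ᴿ_ : Rel ℝ 0ℓ
x ≤ᴿ y = ∀ ε → 0ℚ ℚ.< ε →
  ∃[ N ] (∀ n → N ℕ.≤ n → seq x n ℚ.≤ seq y n ℚ.+ ε)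

_<ᴿ_ : Rel ℝ 0ℓ
x <ᴿ y = ∃[ ε ] 0ℚ ℚ.< ε ×
  ∃[ N ] (∀ n → N ℕ.≤ n → seq x n ℚ.+ ε ℚ.≤ seq y n)

private
  interchange : ∀ a b c d →
    (a ℚ.+ b) ℚ.- (c ℚ.+ d) ≡ (a ℚ.- c) ℚ.+ (b ℚ.- d)
  interchange = solve 4
    (λ a b c d → (a :+ b) :- (c :+ d) := (a :- c) :+ (b :- d)) refl
    where open +-*-Solver

  halves : ∀ ε → ½ ℚ.* ε ℚ.+ ½ ℚ.* ε ≡ ε
  halves ε = trans (sym (ℚ.*-distribʳ-+ ε ½ ½)) (ℚ.*-identityˡ ε)

  half>0 : ∀ ε → 0ℚ ℚ.< ε → 0ℚ ℚ.< ½ ℚ.* ε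
  half>0 ε ε>0 = subst (ℚ._< ½ ℚ.* ε) (ℚ.*-zeroʳ ½) (ℚ.*-monoʳ-<-pos ½ ε>0)

  +-cauchy : ∀ {x y} → Cauchy x → Cauchy y → Cauchy (λ n → x n ℚ.+ y n)
  +-cauchy {x} {y} cx cy ε ε>0
    with cx (½ ℚ.* ε) (half>0 ε ε>0) | cy (½ ℚ.* ε) (half>0 ε ε>0)
  ... | M , p | N , q = M ℕ.⊔ N , λ m n M⊔N≤m M⊔N≤n → begin-strict
    ℚ.∣ (x m ℚ.+ y m) ℚ.- (x n ℚ.+ y n) ∣
      ≡⟨ cong ℚ.∣_∣ (interchange (x m) (y m) (x n) (y n)) ⟩
    ℚ.∣ (x m ℚ.- x n) ℚ.+ (y m ℚ.- y n) ∣
      ≤⟨ ℚ.∣p+q∣≤∣p∣+∣q∣ (x m ℚ.- x n) (y m ℚ.- y n) ⟩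
    ℚ.∣ x m ℚ.- x n ∣ ℚ.+ ℚ.∣ y m ℚ.- y n ∣
      <⟨ ℚ.+-mono-<
           (p m n (ℕ.m⊔n≤o⇒m≤o M N M⊔N≤m) (ℕ.m⊔n≤o⇒m≤o M N M⊔N≤n))
           (q m n (ℕ.m⊔n≤o⇒n≤o M N M⊔N≤m) (ℕ.m⊔n≤o⇒n≤o M N M⊔N≤n)) ⟩
    ½ ℚ.* ε ℚ.+ ½ ℚ.* ε
      ≡⟨ halves ε ⟩
    ε ∎
    where open ℚ.≤-Reasoning

_+ᴿ_ : ℝ → ℝ → ℝ
x +ᴿ y = mkℝ (λ n → seq x n ℚ.+ seq y n)
  (+-cauchy {seq x} {seq y} (cauchy x) (cauchy y))

record Graph : Set₁ where
  field
    order      : ℕ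
    Adj        : Rel (Fin order) 0ℓ
    Adj-sym    : Symmetric Adj
    Adj-irrefl : ∀ u → ¬ Adj u u
    Adj?       : Decidable Adj

-- The set of indices satisfying P is asked for explicitly, because the
-- order on ℝ is not decidable and so the indices cannot be counted by a
-- function.
HoldsOddlyOften : ∀ {k} → (Fin k → Set) → Set
HoldsOddlyOften {k} P =
  Σ[ S ∈ Subset k ] (∀ i → i ∈ S ⇔ P i) × ∣ S ∣ % 2 ≡ 1

module _ (G : Graph) where
  open Graph G

  IsRepresentation : ∀ {k} → (Fin k → ℝ) → (Fin order → ℝ) → Set
  IsRepresentation θ r = ∀ u v → u ≢ v →
    Adj u v ⇔ HoldsOddlyOften (λ i → θ i ≤ᴿ r u +ᴿ r v)

  IsThresholdGraph : ℕ → Set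
  IsThresholdGraph k =
    Σ[ θ ∈ (Fin k → ℝ) ] (∀ i j → i Fin.< j → θ i <ᴿ θ j) ×
    Σ[ r ∈ (Fin order → ℝ) ] IsRepresentation θ r

  -- Θ(G) = k, as a relation.
  ThresholdNumber : ℕ → Set
  ThresholdNumber k =
    1 ℕ.≤ k × IsThresholdGraph k ×
    (∀ j → 1 ℕ.≤ j → IsThresholdGraph j → k ℕ.≤ j)

-- v follows u in the cyclic order 0, 1, …, n - 1, 0.
Next : ∀ {n} → Rel (Fin n) 0ℓ
Next {n} u v = suc (toℕ u) ≡ toℕ v ⊎ (suc (toℕ u) ≡ n × toℕ v ≡ 0)

private
  next? : ∀ {n} → Decidable (Next {n})
  next? {n} u v = (suc (toℕ u) ℕ.≟ toℕ v) ⊎-dec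
    ((suc (toℕ u) ℕ.≟ n) ×-dec (toℕ v ℕ.≟ 0))

  next-irrefl : ∀ {n} → 3 ℕ.≤ n → (u : Fin n) → ¬ Next u u
  next-irrefl _   u (inj₁ 1+u≡u) = ℕ.1+n≢n 1+u≡u
  next-irrefl 3≤n u (inj₂ (1+u≡n , u≡0)) =
    ℕ.<⇒≱ (ℕ.s≤s (ℕ.s≤s ℕ.z≤n))
      (subst (3 ℕ.≤_) (trans (sym 1+u≡n) (cong suc u≡0)) 3≤n)

cycle : ∀ n → 3 ℕ.≤ n → Graph
cycle n 3≤n = record
  { order      = n
  ; Adj        = λ u v → Next u v ⊎ Next v u
  ; Adj-sym    = swap
  ; Adj-irrefl = λ { u (inj₁ p) → next-irrefl 3≤n u p
                   ; u (inj₂ p) → next-irrefl 3≤n u p }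
  ; Adj?       = λ u v → next? u v ⊎-dec next? v u
  }

{-# OPTIONS --safe #-}

-- Lower bound for n ≥ 5: at most three thresholds leave the edge sums in
-- [θ₁, θ₂) ∪ [θ₃, ∞).  Let m have the least rank, let b, a be its neighbours
-- with r b ≤ r a, and continue the cycle as b m a c d e.  The nonedge b c has
-- a sum ≥ r b + r m ≥ θ₁, hence ≥ θ₂, so the edge a c has a sum ≥ θ₃.  The
-- vertex of greatest rank then has sums ≥ θ₃ with a or with c, so it is a or
-- c itself, and either case makes some nonedge reach θ₃.  Only comparisons of
-- sums are used, so the argument runs under a double negation.
--
-- Upper bound for n ≥ 5: give consecutive vertices ranks alternating about a
-- centre, so that consecutive sums fill a narrow window; the closing edge has
-- a sum that no other pair attains and gets a window of its own.

module Submission where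

open import Defs
open import Data.Bool using (true; false)
open import Data.Empty using (⊥)
open import Data.Fin as Fin using (Fin; zero; suc; toℕ; fromℕ<)
import Data.Fin.Properties as Fin
open import Data.Fin.Subset using (∣_∣)
open import Data.Fin.Subset.Properties using (_∈?_)
open import Data.Integer as ℤ using (+_)
import Data.Integer.Properties as ℤ
open import Data.Nat using (ℕ; _≤_)
open import Data.Nat as ℕ
  using (zero; suc; _+_; _*_; _%_; _<_; _⊔_; s≤s; z≤n; NonZero; parity)
import Data.Nat.Coprimality as Coprime
open import Data.Nat.Divisibility using (divides; >⇒∤)
import Data.Nat.Properties as ℕ
open import Data.Nat.Tactic.RingSolver using (solve-∀)
open import Data.Parity using (0ℙ; 1ℙ)
import Data.Parity.Properties as ℙ
open import Data.Product using (∃-syntax; _×_; _,_; proj₁; proj₂)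
open import Data.Rational as ℚ using (ℚ; 0ℚ; 1ℚ; ½; mkℚ)
import Data.Rational.Properties as ℚ
open import Data.Rational.Solver using (module +-*-Solver)
open import Data.Sum using (_⊎_; inj₁; inj₂; swap)
open import Data.Vec using (tabulate; lookup)
open import Data.Vec.Properties
  using (lookup∘tabulate; tabulate∘lookup; tabulate-cong; lookup⇒[]=; []=⇒lookup)
open import Function.Base using (flip; _∘_)
open import Function.Bundles using (_⇔_; mk⇔; module Equivalence)
open import Level using (0ℓ)
open import Relation.Binary.Core using (Rel)
open import Relation.Binary.Definitions
  using (Reflexive; Transitive; Symmetric; tri<; tri≈; tri>)
open import Relation.Binary.PropositionalEquality
open import Relation.Nullary.Decidable
  using (Dec; yes; no; does; map′; from-yes; ¬?; _→-dec_; _×-dec_)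
open import Relation.Nullary.Negation using (¬_; contradiction)

open +-*-Solver using (solve; _:=_; _:+_; _:-_)

-- Order and addition on the Cauchy reals.

private
  variable
    w x y z : ℝ

halve : ∀ {ε} → 0ℚ ℚ.< ε → ∃[ δ ] 0ℚ ℚ.< δ × δ ℚ.+ δ ≡ ε
halve {ε} ε>0 = ½ ℚ.* ε
  , subst (ℚ._< ½ ℚ.* ε) (ℚ.*-zeroʳ ½) (ℚ.*-monoʳ-<-pos ½ ε>0)
  , trans (sym (ℚ.*-distribʳ-+ ε ½ ½)) (ℚ.*-identityˡ ε)

∣p-q∣<δ⇒p≤q+δ : ∀ p q {δ} → ℚ.∣ p ℚ.- q ∣ ℚ.< δ → p ℚ.≤ q ℚ.+ δ
∣p-q∣<δ⇒p≤q+δ p q {δ} ∣p-q∣<δ = begin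
  p                   ≡⟨ solve 2 (λ p q → p := q :+ (p :- q)) refl p q ⟩
  q ℚ.+ (p ℚ.- q)     ≤⟨ ℚ.+-monoʳ-≤ q (p≤∣p∣ (p ℚ.- q)) ⟩
  q ℚ.+ ℚ.∣ p ℚ.- q ∣ ≤⟨ ℚ.+-monoʳ-≤ q (ℚ.<⇒≤ ∣p-q∣<δ) ⟩
  q ℚ.+ δ             ∎
  where
  open ℚ.≤-Reasoning
  p≤∣p∣ : ∀ p → p ℚ.≤ ℚ.∣ p ∣
  p≤∣p∣ p with ℚ.≤-total 0ℚ p
  ... | inj₁ 0≤p = ℚ.≤-reflexive (sym (ℚ.0≤p⇒∣p∣≡p 0≤p))
  ... | inj₂ p≤0 = ℚ.≤-trans p≤0 (ℚ.0≤∣p∣ p)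

p≤p+ε : ∀ p {ε} → 0ℚ ℚ.< ε → p ℚ.≤ p ℚ.+ ε
p≤p+ε p ε>0 =
  ℚ.≤-trans (ℚ.≤-reflexive (sym (ℚ.+-identityʳ p))) (ℚ.+-monoʳ-≤ p (ℚ.<⇒≤ ε>0))

eventually-≤⇒≤ᴿ : ∀ {x y} N → (∀ n → N ≤ n → seq x n ℚ.≤ seq y n) → x ≤ᴿ y
eventually-≤⇒≤ᴿ {y = y} N x≤y ε ε>0 =
  N , λ n N≤n → ℚ.≤-trans (x≤y n N≤n) (p≤p+ε (seq y n) ε>0)

≤ᴿ-refl : x ≤ᴿ x
≤ᴿ-refl {x} = eventually-≤⇒≤ᴿ {x} {x} 0 λ _ _ → ℚ.≤-refl

≤ᴿ-trans : x ≤ᴿ y → y ≤ᴿ z → x ≤ᴿ z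
≤ᴿ-trans {x} {y} {z} x≤y y≤z ε ε>0 with halve ε>0
... | δ , δ>0 , refl with x≤y δ δ>0 | y≤z δ δ>0
... | M , p | N , q = M ⊔ N , λ n M⊔N≤n → begin
  seq x n               ≤⟨ p n (ℕ.m⊔n≤o⇒m≤o M N M⊔N≤n) ⟩
  seq y n ℚ.+ δ         ≤⟨ ℚ.+-monoˡ-≤ δ (q n (ℕ.m⊔n≤o⇒n≤o M N M⊔N≤n)) ⟩
  (seq z n ℚ.+ δ) ℚ.+ δ ≡⟨ ℚ.+-assoc (seq z n) δ δ ⟩
  seq z n ℚ.+ (δ ℚ.+ δ) ∎
  where open ℚ.≤-Reasoning

+ᴿ-mono-≤ᴿ : w ≤ᴿ x → y ≤ᴿ z → w +ᴿ y ≤ᴿ x +ᴿ z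
+ᴿ-mono-≤ᴿ {w} {x} {y} {z} w≤x y≤z ε ε>0 with halve ε>0
... | δ , δ>0 , refl with w≤x δ δ>0 | y≤z δ δ>0
... | M , p | N , q = M ⊔ N , λ n M⊔N≤n → begin
  seq w n ℚ.+ seq y n
    ≤⟨ ℚ.+-mono-≤ (p n (ℕ.m⊔n≤o⇒m≤o M N M⊔N≤n)) (q n (ℕ.m⊔n≤o⇒n≤o M N M⊔N≤n)) ⟩
  (seq x n ℚ.+ δ) ℚ.+ (seq z n ℚ.+ δ)
    ≡⟨ solve 3 (λ a b d → (a :+ d) :+ (b :+ d) := (a :+ b) :+ (d :+ d)) refl
         (seq x n) (seq z n) δ ⟩
  (seq x n ℚ.+ seq z n) ℚ.+ (δ ℚ.+ δ) ∎
  where open ℚ.≤-Reasoning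

+ᴿ-comm-≤ᴿ : x +ᴿ y ≤ᴿ y +ᴿ x
+ᴿ-comm-≤ᴿ {x} {y} = eventually-≤⇒≤ᴿ {x +ᴿ y} {y +ᴿ x} 0
  λ n _ → ℚ.≤-reflexive (ℚ.+-comm (seq x n) (seq y n))

<ᴿ⇒≤ᴿ : x <ᴿ y → x ≤ᴿ y
<ᴿ⇒≤ᴿ {x} {y} (ε , ε>0 , N , x+ε≤y) = eventually-≤⇒≤ᴿ {x} {y} N
  λ n N≤n → ℚ.≤-trans (p≤p+ε (seq x n) ε>0) (x+ε≤y n N≤n)

-- If at some late index y exceeds x by more than twice the oscillation δ,
-- then x ≤ y throughout the tail.
≰ᴿ⇒≥ᴿ : ¬ x ≤ᴿ y → y ≤ᴿ x
≰ᴿ⇒≥ᴿ {x} {y} x≰y ε ε>0 with halve ε>0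
... | γ , γ>0 , refl with halve γ>0
... | δ , δ>0 , refl with cauchy x δ δ>0 | cauchy y δ δ>0
... | M , cx | N , cy with seq y (M ⊔ N) ℚ.≤? seq x (M ⊔ N) ℚ.+ (δ ℚ.+ δ)
... | yes y≤x+2δ = M ⊔ N , λ n K≤n → begin
  seq y n                    ≤⟨ ∣p-q∣<δ⇒p≤q+δ (seq y n) (seq y K)
                                  (cy n K (ℕ.m⊔n≤o⇒n≤o M N K≤n) (ℕ.m≤n⊔m M N)) ⟩
  seq y K ℚ.+ δ              ≤⟨ ℚ.+-monoˡ-≤ δ y≤x+2δ ⟩
  (seq x K ℚ.+ (δ ℚ.+ δ)) ℚ.+ δ
    ≤⟨ ℚ.+-monoˡ-≤ δ (ℚ.+-monoˡ-≤ (δ ℚ.+ δ) (∣p-q∣<δ⇒p≤q+δ (seq x K) (seq x n)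
         (cx K n (ℕ.m≤m⊔n M N) (ℕ.m⊔n≤o⇒m≤o M N K≤n)))) ⟩
  ((seq x n ℚ.+ δ) ℚ.+ (δ ℚ.+ δ)) ℚ.+ δ
    ≡⟨ solve 2 (λ a d → ((a :+ d) :+ (d :+ d)) :+ d := a :+ ((d :+ d) :+ (d :+ d)))
         refl (seq x n) δ ⟩
  seq x n ℚ.+ ((δ ℚ.+ δ) ℚ.+ (δ ℚ.+ δ)) ∎
  where
  open ℚ.≤-Reasoning
  K : ℕ
  K = M ⊔ N
... | no y≰x+2δ = contradiction (eventually-≤⇒≤ᴿ {x} {y} K x≤y) x≰y
  where
  open ℚ.≤-Reasoning
  K : ℕ
  K = M ⊔ N
  cancel : ∀ a d → (a ℚ.+ d) ℚ.- d ≡ a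
  cancel = solve 2 (λ a d → (a :+ d) :- d := a) refl
  x≤y : ∀ n → K ≤ n → seq x n ℚ.≤ seq y n
  x≤y n K≤n = begin
    seq x n
      ≤⟨ ∣p-q∣<δ⇒p≤q+δ (seq x n) (seq x K)
           (cx n K (ℕ.m⊔n≤o⇒m≤o M N K≤n) (ℕ.m≤m⊔n M N)) ⟩
    seq x K ℚ.+ δ
      ≡⟨ solve 2 (λ a d → a :+ d := (a :+ (d :+ d)) :- d) refl (seq x K) δ ⟩
    (seq x K ℚ.+ (δ ℚ.+ δ)) ℚ.- δ
      ≤⟨ ℚ.+-monoˡ-≤ (ℚ.- δ) (ℚ.<⇒≤ (ℚ.≰⇒> y≰x+2δ)) ⟩
    seq y K ℚ.- δ
      ≤⟨ ℚ.+-monoˡ-≤ (ℚ.- δ) (∣p-q∣<δ⇒p≤q+δ (seq y K) (seq y n)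
           (cy K n (ℕ.m≤n⊔m M N) (ℕ.m⊔n≤o⇒n≤o M N K≤n))) ⟩
    (seq y n ℚ.+ δ) ℚ.- δ
      ≡⟨ cancel (seq y n) δ ⟩
    seq y n ∎

-- Extremal vertices and levels of a representation.

-- The order on reals is undecidable, so a least element is only found up to double negation. If `m`
-- is least in the tail and `zero` is not least overall, then `zero ≼ suc m` fails, and `⋠⇒≽` makes
-- `suc m` least.
¬¬-minimum : ∀ {n} (_≼_ : Rel (Fin (suc n)) 0ℓ) →
  Reflexive _≼_ → Transitive _≼_ → (∀ {u v} → ¬ u ≼ v → v ≼ u) →
  ¬ ¬ (∃[ m ] ∀ v → m ≼ v)
¬¬-minimum {zero} _≼_ ≼-refl _ _ ¬min = ¬min (zero , λ { zero → ≼-refl })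
¬¬-minimum {suc n} _≼_ ≼-refl ≼-trans ⋠⇒≽ ¬min =
  ¬¬-minimum (λ u v → suc u ≼ suc v) ≼-refl ≼-trans ⋠⇒≽ λ (m , m≼) →
  let 0⋠m : ¬ zero ≼ suc m
      0⋠m 0≼m = ¬min (zero , λ { zero → ≼-refl ; (suc v) → ≼-trans 0≼m (m≼ v) })
  in ¬min (suc m , λ { zero → ⋠⇒≽ 0⋠m ; (suc v) → m≼ v })

-- Keeps what the lower bound needs from "the sum reaches a threshold": monotonicity in one
-- argument, hence by symmetry in both. The empty relation qualifies as well.
record IsLevel {n} (_≼_ K : Rel (Fin n) 0ℓ) : Set where
  field
    symmetric : Symmetric K
    upward    : ∀ {u v w} → u ≼ v → K u w → K v w

-- A representation with thresholds θ₁ < θ₂ < θ₃ seen through the orders it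
-- induces: u ≼ v is r u ≤ r v, and L u v, M u v, H u v say that r u + r v
-- reaches θ₁, θ₂, θ₃.  With fewer thresholds, the missing levels are empty.
record Levels (G : Graph) : Set₁ where
  open Graph G
  infix 4 _≼_
  field
    _≼_       : Rel (Fin order) 0ℓ
    ≼-refl    : Reflexive _≼_
    ≼-trans   : Transitive _≼_
    ≼-switch  : ∀ {u v} → ¬ u ≼ v → v ≼ u
    L M H     : Rel (Fin order) 0ℓ
    isL       : IsLevel _≼_ L
    isM       : IsLevel _≼_ M
    isH       : IsLevel _≼_ H
    edge      : ∀ {u v} → Adj u v → L u v × (M u v → H u v)
    nonedge-M : ∀ {u v} → u ≢ v → ¬ Adj u v → L u v → ¬ ¬ M u v
    nonedge-H : ∀ {u v} → u ≢ v → ¬ Adj u v → ¬ H u v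

-- Parity of the number of thresholds reached.

module _ {k} {P : Fin k → Set} where

  odd-count⇒oddly : (P? : ∀ i → Dec (P i)) →
    ∣ tabulate (does ∘ P?) ∣ % 2 ≡ 1 → HoldsOddlyOften P
  odd-count⇒oddly P? odd = tabulate (does ∘ P?) , ∈⇔ , odd
    where
    ∈⇔ : ∀ i → _
    ∈⇔ i with P? i in eq
    ... | yes p = mk⇔ (λ _ → p) λ _ → lookup⇒[]= i _
      (trans (lookup∘tabulate (does ∘ P?) i) (cong does eq))
    ... | no ¬p = mk⇔ (λ i∈ → contradiction
      (trans (sym ([]=⇒lookup i∈)) (trans (lookup∘tabulate (does ∘ P?) i) (cong does eq)))
      λ ()) λ p → contradiction p ¬p

  -- The witnessing subset and the tabulated decisions have the same members, so the parity is the
  -- same for every decision procedure.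
  oddly⇒odd-count : HoldsOddlyOften P → (P? : ∀ i → Dec (P i)) →
    ∣ tabulate (does ∘ P?) ∣ % 2 ≡ 1
  oddly⇒odd-count (S , ∈⇔ , odd) P? =
    subst (λ T → ∣ T ∣ % 2 ≡ 1)
      (trans (sym (tabulate∘lookup S)) (tabulate-cong same)) odd
    where
    same : ∀ i → lookup S i ≡ does (P? i)
    same i with P? i
    ... | yes p = []=⇒lookup (Equivalence.from (∈⇔ i) p)
    ... | no ¬p with lookup S i in eq
    ...   | false = refl
    ...   | true  = contradiction (Equivalence.to (∈⇔ i) (lookup⇒[]= i S eq)) ¬p

  -- Membership in the witnessing subset is decidable, so an edge makes its own threshold
  -- comparisons decidable although `≤ᴿ` is not.
  oddly⇒dec : HoldsOddlyOften P → ∀ i → Dec (P i)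
  oddly⇒dec (S , ∈⇔ , _) i =
    map′ (Equivalence.to (∈⇔ i)) (Equivalence.from (∈⇔ i)) (i ∈? S)

OddCount : ∀ {k} {P : Fin k → Set} → (∀ i → Dec (P i)) → Set
OddCount P? = ∣ tabulate (does ∘ P?) ∣ % 2 ≡ 1

pattern 0F = zero
pattern 1F = suc zero
pattern 2F = suc (suc zero)
pattern 3F = suc (suc (suc zero))

odd-count₁⇒ : {P : Fin 1 → Set} (P? : ∀ i → Dec (P i)) → OddCount P? → P 0F
odd-count₁⇒ P? odd with P? 0F
... | yes p₀ = p₀
odd-count₁⇒ P? () | no _

odd-count₂⇒ : {P : Fin 2 → Set} → (P 1F → P 0F) →
  (P? : ∀ i → Dec (P i)) → OddCount P? → P 0F × ¬ P 1F
odd-count₂⇒ 1⇒0 P? odd with P? 0F | P? 1F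
... | yes p₀ | no ¬p₁ = p₀ , ¬p₁
... | no ¬p₀ | yes p₁ = contradiction (1⇒0 p₁) ¬p₀
odd-count₂⇒ 1⇒0 P? () | yes _ | yes _
odd-count₂⇒ 1⇒0 P? () | no _ | no _

-- The indices reached form an initial segment, whose odd size is 1 or 3.
odd-count₃⇒ : {P : Fin 3 → Set} → (P 1F → P 0F) → (P 2F → P 1F) →
  (P? : ∀ i → Dec (P i)) → OddCount P? → P 0F × (P 1F → P 2F)
odd-count₃⇒ 1⇒0 2⇒1 P? odd with P? 0F | P? 1F | P? 2F
... | yes p₀ | no ¬p₁ | no _ = p₀ , λ p₁ → contradiction p₁ ¬p₁
... | yes p₀ | yes _ | yes p₂ = p₀ , λ _ → p₂
... | _ | no ¬p₁ | yes p₂ = contradiction (2⇒1 p₂) ¬p₁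
... | no ¬p₀ | yes p₁ | _ = contradiction (1⇒0 p₁) ¬p₀
odd-count₃⇒ 1⇒0 2⇒1 P? () | yes _ | yes _ | no _
odd-count₃⇒ 1⇒0 2⇒1 P? () | no _ | no _ | no _

-- From at most three thresholds to levels.

module _ {n} (r : Fin n → ℝ) where

  _≼[r]_ : Rel (Fin n) 0ℓ
  u ≼[r] v = r u ≤ᴿ r v

  Sum≥ : ℝ → Rel (Fin n) 0ℓ
  Sum≥ θ u v = θ ≤ᴿ r u +ᴿ r v

  sum-isLevel : ∀ θ → IsLevel _≼[r]_ (Sum≥ θ)
  sum-isLevel θ = record
    { symmetric = λ {u v} θ≤ → ≤ᴿ-trans {θ} {r u +ᴿ r v} {r v +ᴿ r u} θ≤
        (+ᴿ-comm-≤ᴿ {r u} {r v})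
    ; upward = λ {u v w} u≤v θ≤ → ≤ᴿ-trans {θ} {r u +ᴿ r w} {r v +ᴿ r w} θ≤
        (+ᴿ-mono-≤ᴿ {r u} {r v} {r w} {r w} u≤v (≤ᴿ-refl {r w}))
    }

  empty-isLevel : IsLevel _≼[r]_ (λ _ _ → ⊥)
  empty-isLevel = record { symmetric = λ () ; upward = λ _ () }

  Sum≥-antitone : ∀ {η θ} → η <ᴿ θ → ∀ {u v} → Sum≥ θ u v → Sum≥ η u v
  Sum≥-antitone {η} {θ} η<θ {u} {v} =
    ≤ᴿ-trans {η} {θ} {r u +ᴿ r v} (<ᴿ⇒≤ᴿ {η} {θ} η<θ)

module _ (G : Graph) where
  open Graph G

  Adj⇒≢ : ∀ {u v} → Adj u v → u ≢ v
  Adj⇒≢ uv refl = Adj-irrefl _ uv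

  levels : (r : Fin order → ℝ) {L M H : Rel (Fin order) 0ℓ} →
    IsLevel (_≼[r]_ r) L → IsLevel (_≼[r]_ r) M → IsLevel (_≼[r]_ r) H →
    (∀ {u v} → Adj u v → L u v × (M u v → H u v)) →
    (∀ {u v} → u ≢ v → ¬ Adj u v → L u v → ¬ ¬ M u v) →
    (∀ {u v} → u ≢ v → ¬ Adj u v → ¬ H u v) → Levels G
  levels r isL isM isH edge nonedge-M nonedge-H = record
    { ≼-refl    = λ {u} → ≤ᴿ-refl {r u}
    ; ≼-trans   = λ {u v w} → ≤ᴿ-trans {r u} {r v} {r w}
    ; ≼-switch  = λ {u v} → ≰ᴿ⇒≥ᴿ {r u} {r v}
    ; isL       = isL
    ; isM       = isM
    ; isH       = isH
    ; edge      = edge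
    ; nonedge-M = nonedge-M
    ; nonedge-H = nonedge-H
    }

  -- A nonedge carries no decisions of its own. Assuming `¬ M` settles every comparison, which makes
  -- the count odd and contradicts the nonedge; hence the double negation in `nonedge-M`.
  threshold⇒levels : ∀ {k} → 1 ≤ k → k ≤ 3 → IsThresholdGraph G k → Levels G
  threshold⇒levels {1} _ _ (θ , θ< , r , rep) = levels r
    (sum-isLevel r (θ 0F)) (empty-isLevel r) (empty-isLevel r)
    (λ {u} {v} uv → let odd = Equivalence.to (rep u v (Adj⇒≢ uv)) uv in
      odd-count₁⇒ (oddly⇒dec odd) (oddly⇒odd-count odd (oddly⇒dec odd)) , λ ())
    (λ u≢v ¬uv p₀ _ → ¬uv (Equivalence.from (rep _ _ u≢v)
      (odd-count⇒oddly (λ { 0F → yes p₀ }) refl)))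
    (λ _ _ ())
  threshold⇒levels {2} _ _ (θ , θ< , r , rep) = levels r
    (sum-isLevel r (θ 0F)) (sum-isLevel r (θ 1F)) (empty-isLevel r)
    (λ uv → let odd = Equivalence.to (rep _ _ (Adj⇒≢ uv)) uv in
      odd-count₂⇒ 1⇒0 (oddly⇒dec odd) (oddly⇒odd-count odd (oddly⇒dec odd)))
    (λ u≢v ¬uv p₀ ¬p₁ → ¬uv (Equivalence.from (rep _ _ u≢v)
      (odd-count⇒oddly (λ { 0F → yes p₀ ; 1F → no ¬p₁ }) refl)))
    (λ _ _ ())
    where
    1⇒0 : ∀ {u v} → Sum≥ r (θ 1F) u v → Sum≥ r (θ 0F) u v
    1⇒0 {u} {v} = Sum≥-antitone r {θ 0F} {θ 1F} (θ< 0F 1F (s≤s z≤n)) {u} {v}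
  threshold⇒levels {3} _ _ (θ , θ< , r , rep) = levels r
    (sum-isLevel r (θ 0F)) (sum-isLevel r (θ 1F)) (sum-isLevel r (θ 2F))
    (λ {u} {v} uv → let odd = Equivalence.to (rep u v (Adj⇒≢ uv)) uv in
      odd-count₃⇒ (1⇒0 {u} {v}) (2⇒1 {u} {v})
        (oddly⇒dec odd) (oddly⇒odd-count odd (oddly⇒dec odd)))
    (λ {u} {v} u≢v ¬uv p₀ ¬p₁ → ¬uv (Equivalence.from (rep u v u≢v)
      (odd-count⇒oddly
        (λ { 0F → yes p₀ ; 1F → no ¬p₁ ; 2F → no (¬p₁ ∘ 2⇒1 {u} {v}) }) refl)))
    (λ {u} {v} u≢v ¬uv p₂ → ¬uv (Equivalence.from (rep u v u≢v)
      (odd-count⇒oddly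
        (λ { 0F → yes (1⇒0 {u} {v} (2⇒1 {u} {v} p₂))
           ; 1F → yes (2⇒1 {u} {v} p₂)
           ; 2F → yes p₂
           }) refl)))
    where
    1⇒0 : ∀ {u v} → Sum≥ r (θ 1F) u v → Sum≥ r (θ 0F) u v
    1⇒0 {u} {v} = Sum≥-antitone r {θ 0F} {θ 1F} (θ< 0F 1F (s≤s z≤n)) {u} {v}
    2⇒1 : ∀ {u v} → Sum≥ r (θ 2F) u v → Sum≥ r (θ 1F) u v
    2⇒1 {u} {v} = Sum≥-antitone r {θ 1F} {θ 2F} (θ< 1F 2F (s≤s (s≤s z≤n))) {u} {v}
  threshold⇒levels {suc (suc (suc (suc _)))} _ (s≤s (s≤s (s≤s ())))

-- The contradiction along a path through the least vertex.

Apart : (G : Graph) → Rel (Fin (Graph.order G)) 0ℓ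
Apart G u v = u ≢ v × ¬ Graph.Adj G u v

module _ {G : Graph} (Λ : Levels G) where
  open Graph G
  open Levels Λ
  open IsLevel

  ¬levels-path : ∀ {m p a b c d e} →
    (∀ v → m ≼ v) → (∀ v → v ≼ p) → b ≼ a →
    Adj b m → Adj m a → Adj a c → Adj c d → Adj d e →
    Apart G b a → Apart G b c → Apart G m c → Apart G m d → Apart G c e →
    (∀ v → Adj v a → v ≡ m ⊎ v ≡ c) → ⊥
  ¬levels-path {m} {p} {a} {b} {c} {d} {e}
    m≼ ≼p b≼a bm ma ac cd de (b≢a , ¬ba) (b≢c , ¬bc) (m≢c , ¬mc) (m≢d , ¬md)
    (c≢e , ¬ce) nbrs-a =
    nonedge-M b≢c ¬bc Lbc λ Mbc → top-is-a-or-c (proj₂ (edge ac) (upward isM b≼a Mbc))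
    where
    -- Replacing `m` by the no smaller `b` would carry `H` over to the nonedge `b a`.
    ¬Hma : ¬ H m a
    ¬Hma = nonedge-H b≢a ¬ba ∘ upward isH (m≼ b)

    ¬Mma : ¬ M m a
    ¬Mma = ¬Hma ∘ proj₂ (edge ma)

    Lbm : L b m
    Lbm = proj₁ (edge bm)

    Lbc : L b c
    Lbc = symmetric isL (upward isL (m≼ c) (symmetric isL Lbm))

    -- If `b ≼ c`, then `L b m` rises to `L m c`, the nonedge `m c` reaches θ₂, and raising `c` to
    -- `a` contradicts `¬Mma`. So `c ≼ b`, and `H a c` rises to the nonedge `b a`.
    top-is-a : H a c → (∀ v → v ≼ a) → ⊥
    top-is-a Hac ≼a = nonedge-H b≢a ¬ba
        (upward isH (≼-switch ¬b≼c) (symmetric isH Hac))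
      where
      ¬b≼c : ¬ b ≼ c
      ¬b≼c b≼c = nonedge-M m≢c ¬mc (symmetric isL (upward isL b≼c Lbm))
        (¬Mma ∘ symmetric isM ∘ upward isM (≼a c) ∘ symmetric isM)

    -- Nonedges and edges alternate in forcing sums upwards: `m c` reaches θ₂, so `c d` reaches θ₃;
    -- then `d ≼ b` would lift the nonedge `b c` to θ₃, so `b ≼ d`. Now `m d` reaches θ₂, so `d e`
    -- reaches θ₃, and so does the nonedge `c e`.
    top-is-c : H a c → (∀ v → v ≼ c) → ⊥
    top-is-c Hac ≼c =
      nonedge-M m≢c ¬mc (up-right (≼c a) (proj₁ (edge ma))) λ Mmc →
      let Hdc = symmetric isH (proj₂ (edge cd) (symmetric isM (upward isM (m≼ d) Mmc)))
          ¬d≼b = λ d≼b → nonedge-H b≢c ¬bc (upward isH d≼b Hdc)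
          Lmd = up-right (≼-switch ¬d≼b) (symmetric isL Lbm)
      in nonedge-M m≢d ¬md Lmd λ Mmd →
      let Hde = proj₂ (edge de) (symmetric isM (upward isM (m≼ e) Mmd))
      in nonedge-H c≢e ¬ce (upward isH (≼c d) Hde)
      where
      up-right : ∀ {u v w} → v ≼ w → L u v → L u w
      up-right v≼w = symmetric isL ∘ upward isL v≼w ∘ symmetric isL

    top-is-a-or-c : ¬ H a c
    top-is-a-or-c Hac with p Fin.≟ a | Adj? p a
    ... | yes refl | _ = top-is-a Hac ≼p
    ... | no p≢a | no ¬pa =
      nonedge-H p≢a ¬pa (upward isH (≼p c) (symmetric isH Hac))
    ... | no _ | yes pa with nbrs-a p pa
    ...   | inj₁ refl = ¬Hma (upward isH (≼p c) (symmetric isH Hac))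
    ...   | inj₂ refl = top-is-c Hac ≼p

-- Arithmetic of the cyclic order.

module _ {n : ℕ} where

  -- Only the congruence modulo `n` is recorded, with `q` counting passages from the last vertex to
  -- 0, so that closed walks become a question of divisibility.
  Walk : ℕ → Rel (Fin n) 0ℓ
  Walk ℓ u v = ∃[ q ] ℓ + toℕ u ≡ q * n + toℕ v

  next⇒walk : ∀ {u v} → Next u v → Walk 1 u v
  next⇒walk (inj₁ 1+u≡v) = 0 , 1+u≡v
  next⇒walk {v = v} (inj₂ (1+u≡n , v≡0)) = 1 , (begin
    _             ≡⟨ 1+u≡n ⟩
    n             ≡⟨ ring n ⟩
    1 * n + 0     ≡⟨ cong (1 * n ℕ.+_) v≡0 ⟨
    1 * n + toℕ v ∎)
    where
    open ≡-Reasoning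
    ring : ∀ n → n ≡ 1 * n + 0
    ring = solve-∀

  infixr 5 _◅_
  _◅_ : ∀ {ℓ u v w} → Next u v → Walk ℓ v w → Walk (suc ℓ) u w
  _◅_ {ℓ} {u} {v} {w} uv (q , q≡) with next⇒walk uv
  ... | r , r≡ = r + q , (begin
    suc (ℓ + toℕ u)         ≡⟨ ℕ.+-suc ℓ (toℕ u) ⟨
    ℓ + suc (toℕ u)         ≡⟨ cong (ℓ ℕ.+_) r≡ ⟩
    ℓ + (r * n + toℕ v)     ≡⟨ ring ℓ (r * n) (toℕ v) ⟩
    r * n + (ℓ + toℕ v)     ≡⟨ cong (r * n ℕ.+_) q≡ ⟩
    r * n + (q * n + toℕ w) ≡⟨ ring′ r q n (toℕ w) ⟩
    (r + q) * n + toℕ w     ∎)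
    where
    open ≡-Reasoning
    ring : ∀ ℓ x v → ℓ + (x + v) ≡ x + (ℓ + v)
    ring = solve-∀
    ring′ : ∀ r q n w → r * n + (q * n + w) ≡ (r + q) * n + w
    ring′ = solve-∀

  -- Cancelling `toℕ u` shows that `n` divides `ℓ`, which is positive and smaller.
  ¬closed-walk : ∀ {ℓ} .{{_ : NonZero ℓ}} → ℓ < n → ∀ {u} → ¬ Walk ℓ u u
  ¬closed-walk {ℓ} ℓ<n {u} (q , q≡) =
    >⇒∤ ℓ<n (divides q (ℕ.+-cancelʳ-≡ (toℕ u) ℓ (q * n) q≡))

  next-functional : ∀ {u v w : Fin n} → Next u v → Next u w → v ≡ w
  next-functional (inj₁ p) (inj₁ q) = Fin.toℕ-injective (trans (sym p) q)
  next-functional {v = v} (inj₁ p) (inj₂ (q , _)) =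
    contradiction (trans (sym p) q) (ℕ.<⇒≢ (Fin.toℕ<n v))
  next-functional {w = w} (inj₂ (p , _)) (inj₁ q) =
    contradiction (trans (sym q) p) (ℕ.<⇒≢ (Fin.toℕ<n w))
  next-functional (inj₂ (_ , p)) (inj₂ (_ , q)) = Fin.toℕ-injective (trans p (sym q))

  next-injective : ∀ {u v w : Fin n} → Next u w → Next v w → u ≡ v
  next-injective (inj₁ p) (inj₁ q) =
    Fin.toℕ-injective (ℕ.suc-injective (trans p (sym q)))
  next-injective (inj₁ p) (inj₂ (_ , q)) with () ← trans p q
  next-injective (inj₂ (_ , p)) (inj₁ q) with () ← trans q p
  next-injective (inj₂ (p , _)) (inj₂ (q , _)) =
    Fin.toℕ-injective (ℕ.suc-injective (trans p (sym q)))

next-exists : ∀ {n} (u : Fin n) → ∃[ v ] Next u v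
next-exists {suc n} u with suc (toℕ u) ℕ.<? suc n
... | yes 1+u<n = fromℕ< 1+u<n , inj₁ (sym (Fin.toℕ-fromℕ< 1+u<n))
... | no 1+u≮n = zero , inj₂ (ℕ.≤-antisym (Fin.toℕ<n u) (ℕ.≮⇒≥ 1+u≮n) , refl)

previous-exists : ∀ {n} (v : Fin n) → ∃[ u ] Next u v
previous-exists {suc n} zero = Fin.fromℕ n , inj₂ (cong suc (Fin.toℕ-fromℕ n) , refl)
previous-exists {suc n} (suc v) = Fin.inject₁ v , inj₁ (cong suc (Fin.toℕ-inject₁ v))

-- The two directions around the cycle.

-- `R` is one sense of traversal. Abstracting over it lets the path argument run both ways,
-- whichever neighbour of the least vertex has the smaller rank.
record Rotation (G : Graph) (R : Rel (Fin (Graph.order G)) 0ℓ) : Set where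
  open Graph G
  field
    step   : ∀ u → ∃[ v ] R u v
    adj    : ∀ {u v} → R u v → Adj u v
    apart₂ : ∀ {u v w} → R u v → R v w → Apart G u w
    apart₃ : ∀ {u v w x} → R u v → R v w → R w x → Apart G u x
    nbrs   : ∀ {u v w} → R u v → R v w → ∀ x → Adj x v → x ≡ u ⊎ x ≡ w

module _ {n} (3≤n : 3 ≤ n) (5≤n : 5 ≤ n) where

  open Graph (cycle n 3≤n) using (Adj)

  Apart-sym : ∀ {u v} → Apart (cycle n 3≤n) u v → Apart (cycle n 3≤n) v u
  Apart-sym (u≢v , ¬uv) = u≢v ∘ sym , ¬uv ∘ swap

  next-rotation : Rotation (cycle n 3≤n) Next
  next-rotation = record
    { step   = next-exists
    ; adj    = inj₁
    ; apart₂ = apart₂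
    ; apart₃ = apart₃
    ; nbrs   = λ uv vw x → λ
        { (inj₁ xv) → inj₁ (next-injective xv uv)
        ; (inj₂ vx) → inj₂ (next-functional vx vw)
        }
    }
    where
    1<n : 1 < n
    1<n = ℕ.≤-trans (s≤s (s≤s z≤n)) 5≤n

    2<n : 2 < n
    2<n = 3≤n

    3<n : 3 < n
    3<n = ℕ.≤-trans (ℕ.n≤1+n 4) 5≤n

    apart₂ : ∀ {u v w} → Next u v → Next v w → Apart (cycle n 3≤n) u w
    apart₂ uv vw = (λ { refl → ¬closed-walk 2<n (uv ◅ next⇒walk vw) }) , λ
      { (inj₁ uw) → ¬closed-walk 1<n (next⇒walk
          (subst (Next _) (next-functional uw uv) vw))
      ; (inj₂ wu) → ¬closed-walk 3<n (uv ◅ vw ◅ next⇒walk wu)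
      }

    apart₃ : ∀ {u v w x} → Next u v → Next v w → Next w x →
      Apart (cycle n 3≤n) u x
    apart₃ uv vw wx = (λ { refl → ¬closed-walk 3<n (uv ◅ vw ◅ next⇒walk wx) }) , λ
      { (inj₁ ux) → ¬closed-walk 2<n (vw ◅ next⇒walk
          (subst (Next _) (next-functional ux uv) wx))
      -- The chord back to `u` closes a walk of length four, excluded by `5≤n`.
      ; (inj₂ xu) → ¬closed-walk 5≤n (uv ◅ vw ◅ wx ◅ next⇒walk xu)
      }

  previous-rotation : Rotation (cycle n 3≤n) (flip Next)
  previous-rotation = record
    { step   = previous-exists
    ; adj    = inj₂
    ; apart₂ = λ vu wv → Apart-sym (apart₂ wv vu)
    ; apart₃ = λ vu wv xw → Apart-sym (apart₃ xw wv vu)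
    ; nbrs   = λ vu wv x → swap ∘ nbrs wv vu x
    }
    where open Rotation next-rotation

¬levels-rotation : ∀ {G R} (Λ : Levels G) → Rotation G R →
  let open Levels Λ in ∀ {m p a b} → (∀ v → m ≼ v) → (∀ v → v ≼ p) →
  R b m → R m a → ¬ b ≼ a
¬levels-rotation Λ rot {a = a} m≼ ≼p bm ma b≼a with step a
  where open Rotation rot
... | c , ac with Rotation.step rot c
... | d , cd with Rotation.step rot d
... | e , de = ¬levels-path Λ m≼ ≼p b≼a
  (adj bm) (adj ma) (adj ac) (adj cd) (adj de)
  (apart₂ bm ma) (apart₃ bm ma ac) (apart₂ ma ac) (apart₃ ma ac cd)
  (apart₂ cd de) (nbrs ma ac)
  where open Rotation rot

-- The goal is negative, so least and greatest vertices up to double negation suffice. The two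
-- rotations refute both comparisons between the neighbours of `m`.
¬levels-cycle : ∀ {n} (3≤n : 3 ≤ n) → 5 ≤ n → ¬ Levels (cycle n 3≤n)
¬levels-cycle {suc n} 3≤n 5≤n Λ =
  ¬¬-minimum _≼_ ≼-refl ≼-trans ≼-switch λ (m , m≼) →
  ¬¬-minimum (flip _≼_) ≼-refl (flip ≼-trans) ≼-switch λ (p , ≼p) →
  let b , bm = previous-exists m
      a , ma = next-exists m
      ¬b≼a = ¬levels-rotation Λ (next-rotation 3≤n 5≤n) m≼ ≼p bm ma
      ¬a≼b = ¬levels-rotation Λ (previous-rotation 3≤n 5≤n) m≼ ≼p ma bm
  in ¬a≼b (≼-switch ¬b≼a)
  where open Levels Λ

-- Natural ranks and thresholds inside the reals.

private
  fromℕ : ℕ → ℚ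
  fromℕ m = mkℚ (+ m) 0 (Coprime.sym (Coprime.1-coprimeTo m))

  fromℕ-+ : ∀ a b → fromℕ a ℚ.+ fromℕ b ≡ fromℕ (a + b)
  fromℕ-+ a b = trans
    (ℚ./-cong {q₁ = 1} {q₂ = 1}
      (cong₂ ℤ._+_ (ℤ.*-identityʳ (+ a)) (ℤ.*-identityʳ (+ b))) refl)
    (ℚ.normalize-coprime (Coprime.sym (Coprime.1-coprimeTo (a + b))))

  fromℕ-mono-≤ : ∀ {a b} → a ≤ b → fromℕ a ℚ.≤ fromℕ b
  fromℕ-mono-≤ a≤b = ℚ.*≤* (ℤ.*-monoʳ-≤-nonNeg (+ 1) (ℤ.+≤+ a≤b))

ι : ℕ → ℝ
ι m = mkℝ (λ _ → fromℕ m) λ ε ε>0 → 0 , λ _ _ _ _ →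
  subst (λ d → ℚ.∣ d ∣ ℚ.< ε) (sym (ℚ.+-inverseʳ (fromℕ m))) ε>0

ι-mono-< : ∀ {a b} → a < b → ι a <ᴿ ι b
ι-mono-< {a} {b} a<b = 1ℚ , ℚ.positive⁻¹ 1ℚ , 0 , λ _ _ →
  subst (ℚ._≤ fromℕ b) (trans (cong fromℕ (ℕ.+-comm 1 a)) (sym (fromℕ-+ a 1)))
    (fromℕ-mono-≤ a<b)

ι-+-≤⇔ : ∀ {θ a b} → θ ≤ a + b ⇔ ι θ ≤ᴿ ι a +ᴿ ι b
ι-+-≤⇔ {θ} {a} {b} = mk⇔ to from
  where
  to : θ ≤ a + b → ι θ ≤ᴿ ι a +ᴿ ι b
  to θ≤ = eventually-≤⇒≤ᴿ {ι θ} {ι a +ᴿ ι b} 0 λ _ _ →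
    subst (fromℕ θ ℚ.≤_) (sym (fromℕ-+ a b)) (fromℕ-mono-≤ θ≤)
  from : ι θ ≤ᴿ ι a +ᴿ ι b → θ ≤ a + b
  -- Distinct naturals differ by at least 1, so slack ½ at a single index is enough.
  from θ≤ with θ≤ ½ (ℚ.positive⁻¹ ½)
  ... | N , θ≤a+b+½ = ℕ.≮⇒≥ λ a+b<θ → ℚ.<-irrefl refl (begin-strict
    fromℕ θ                     ≤⟨ θ≤a+b+½ N ℕ.≤-refl ⟩
    (fromℕ a ℚ.+ fromℕ b) ℚ.+ ½ <⟨ ℚ.+-monoʳ-< (fromℕ a ℚ.+ fromℕ b)
                                           (from-yes (½ ℚ.<? fromℕ 1)) ⟩
    (fromℕ a ℚ.+ fromℕ b) ℚ.+ fromℕ 1 ≡⟨ cong (ℚ._+ fromℕ 1) (fromℕ-+ a b) ⟩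
    fromℕ (a + b) ℚ.+ fromℕ 1         ≡⟨ fromℕ-+ (a + b) 1 ⟩
    fromℕ (a + b + 1)                 ≡⟨ cong fromℕ (ℕ.+-comm (a + b) 1) ⟩
    fromℕ (suc (a + b))               ≤⟨ fromℕ-mono-≤ a+b<θ ⟩
    fromℕ θ                           ∎)
    where open ℚ.≤-Reasoning

module _ (G : Graph) {k} (θ : Fin k → ℕ) (r : Fin (Graph.order G) → ℕ) where
  open Graph G

  reached? : ∀ u v i → Dec (θ i ≤ r u + r v)
  reached? u v i = θ i ℕ.≤? r u + r v

  -- Over the naturals every comparison is decidable, so a representation can be checked by
  -- counting; `ι` transports the decisions to the reals.
  natural-threshold : (∀ i j → i Fin.< j → θ i < θ j) →
    (∀ u v → u ≢ v → Adj u v ⇔ OddCount (reached? u v)) →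
    IsThresholdGraph G k
  natural-threshold θ< rep = ι ∘ θ , (λ i j i<j → ι-mono-< (θ< i j i<j)) , ι ∘ r ,
    λ u v u≢v →
      let ιreached? = λ i → map′ (Equivalence.to (ι-+-≤⇔ {θ i} {r u} {r v}))
                                 (Equivalence.from (ι-+-≤⇔ {θ i} {r u} {r v}))
                                 (reached? u v i)
      in mk⇔
        (λ uv → odd-count⇒oddly ιreached? (Equivalence.to (rep u v u≢v) uv))
        (λ odd → Equivalence.from (rep u v u≢v) (oddly⇒odd-count odd ιreached?))

-- Raising the lower of v, w turns one of the edges u v, x w into one of the
-- nonedges u w, x v without lowering the sum.
¬threshold₁ : (G : Graph) → let open Graph G in ∀ {u v w x} →
  Adj u v → Adj x w → u ≢ w → ¬ Adj u w → x ≢ v → ¬ Adj x v →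
  ¬ IsThresholdGraph G 1
¬threshold₁ G {u} {v} {w} {x} uv xw u≢w ¬uw x≢v ¬xv (θ , _ , r , rep) =
  ¬raised xw x≢v ¬xv (≰ᴿ⇒≥ᴿ {r v} {r w} (¬raised uv u≢w ¬uw))
  where
  open Graph G
  open IsLevel (sum-isLevel r (θ 0F))
  ¬raised : ∀ {u v w} → Adj u v → u ≢ w → ¬ Adj u w → ¬ r v ≤ᴿ r w
  ¬raised {u} {v} {w} uv u≢w ¬uw v≤w = ¬uw (Equivalence.from (rep u w u≢w)
    (odd-count⇒oddly {P = λ i → θ i ≤ᴿ r u +ᴿ r w} (λ { 0F → yes θ≤uw }) refl))
    where
    odd : HoldsOddlyOften (λ i → θ i ≤ᴿ r u +ᴿ r v)
    odd = Equivalence.to (rep u v (Adj⇒≢ G uv)) uv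
    θ≤uv : θ 0F ≤ᴿ r u +ᴿ r v
    θ≤uv = odd-count₁⇒ (oddly⇒dec odd) (oddly⇒odd-count odd (oddly⇒dec odd))
    θ≤uw : θ 0F ≤ᴿ r u +ᴿ r w
    θ≤uw = symmetric {w} {u} (upward {v} {w} {u} v≤w (symmetric {u} {v} θ≤uv))

-- The cycles on three and four vertices.

cycle₃-threshold : ∀ 3≤3 → IsThresholdGraph (cycle 3 3≤3) 1
cycle₃-threshold 3≤3 = natural-threshold (cycle 3 3≤3) (λ _ → 0) (λ _ → 0)
  (λ { 0F 0F () }) λ u v u≢v → mk⇔ (λ _ → refl) λ _ → adjacent u v u≢v
  where
  open Graph (cycle 3 3≤3)
  adjacent : ∀ u v → u ≢ v → Adj u v
  adjacent = from-yes (Fin.all? λ u → Fin.all? λ v → ¬? (u Fin.≟ v) →-dec Adj? u v)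

-- Ranks 0, 1, 0, 1 give every edge the sum 1 and the diagonals 0 and 2; only 1 lies between the
-- thresholds 1 and 2.
cycle₄-threshold : ∀ 3≤4 → IsThresholdGraph (cycle 4 3≤4) 2
cycle₄-threshold 3≤4 = natural-threshold (cycle 4 3≤4) θ r
  (λ { 0F 1F _ → s≤s (s≤s z≤n) ; 0F 0F () ; 1F 0F () ; 1F 1F (s≤s ()) })
  λ u v u≢v → mk⇔ (proj₁ (rep u v u≢v)) (proj₂ (rep u v u≢v))
  where
  open Graph (cycle 4 3≤4)
  θ : Fin 2 → ℕ
  θ i = suc (toℕ i)
  r : Fin 4 → ℕ
  r u = toℕ u % 2
  Odd : Rel (Fin 4) 0ℓ
  Odd u v = OddCount (reached? (cycle 4 3≤4) θ r u v)
  odd? : ∀ u v → Dec (Odd u v)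
  odd? u v = _ ℕ.≟ _
  rep : ∀ u v → u ≢ v → (Adj u v → Odd u v) × (Odd u v → Adj u v)
  rep = from-yes (Fin.all? λ u → Fin.all? λ v → ¬? (u Fin.≟ v) →-dec
    ((Adj? u v →-dec odd? u v) ×-dec (odd? u v →-dec Adj? u v)))

cycle₄-¬threshold₁ : ∀ 3≤4 → ¬ IsThresholdGraph (cycle 4 3≤4) 1
cycle₄-¬threshold₁ 3≤4 = ¬threshold₁ (cycle 4 3≤4) {0F} {1F} {2F} {3F}
  (inj₁ (inj₁ refl)) (inj₂ (inj₁ refl)) (λ ())
  (from-yes (¬? (Adj? 0F 2F))) (λ ())
  (from-yes (¬? (Adj? 3F 1F)))
  where open Graph (cycle 4 3≤4)

-- Four thresholds for every cycle.

module _ {P : Fin 4 → Set} (1⇒0 : P 1F → P 0F) (2⇒1 : P 2F → P 1F)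
         (3⇒2 : P 3F → P 2F) (P? : ∀ i → Dec (P i)) where

  odd-count₄⇒ : OddCount P? → (P 0F × ¬ P 1F) ⊎ (P 2F × ¬ P 3F)
  odd-count₄⇒ odd with P? 0F | P? 1F | P? 2F | P? 3F
  ... | yes p₀ | no ¬p₁ | _      | _      = inj₁ (p₀ , ¬p₁)
  ... | _      | _      | yes p₂ | no ¬p₃ = inj₂ (p₂ , ¬p₃)
  ... | no ¬p₀ | yes p₁ | _      | _      = contradiction (1⇒0 p₁) ¬p₀
  ... | _      | _      | no ¬p₂ | yes p₃ = contradiction (3⇒2 p₃) ¬p₂
  odd-count₄⇒ () | yes _ | yes _ | yes _ | yes _
  odd-count₄⇒ () | yes _ | yes _ | no _  | no _
  odd-count₄⇒ () | no _  | no _  | yes _ | yes _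
  odd-count₄⇒ () | no _  | no _  | no _  | no _

  odd-count₄⇐ : (P 0F × ¬ P 1F) ⊎ (P 2F × ¬ P 3F) → OddCount P?
  odd-count₄⇐ w with P? 0F | P? 1F | P? 2F | P? 3F | w
  ... | yes _  | no _   | no _   | no _   | _ = refl
  ... | yes _  | yes _  | yes _  | no _   | _ = refl
  ... | no ¬p₀ | _      | _      | _      | inj₁ (p₀ , _) = contradiction p₀ ¬p₀
  ... | _      | yes p₁ | _      | _      | inj₁ (_ , ¬p₁) = contradiction p₁ ¬p₁
  ... | _      | _      | no ¬p₂ | _      | inj₂ (p₂ , _) = contradiction p₂ ¬p₂
  ... | _      | _      | _      | yes p₃ | inj₂ (_ , ¬p₃) = contradiction p₃ ¬p₃
  ... | no ¬p₀ | yes p₁ | _      | _      | _ = contradiction (1⇒0 p₁) ¬p₀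
  ... | _      | no ¬p₁ | yes p₂ | _      | _ = contradiction (2⇒1 p₂) ¬p₁
  ... | _      | _      | no ¬p₂ | yes p₃ | _ = contradiction (3⇒2 p₃) ¬p₂

-- The cycle on 0, …, N with N = 2 + j.  The ranks of 0, …, N - 1 lie
-- alternately above and below 4N, at distances decreasing in steps of 4, and
-- consecutive sums are 8N ± 4; the last rank is moved off the residue class
-- 0 modulo 4, which makes 12N + 1 the sum of the ranks of N and 0 only.
data Rank (j : ℕ) : ℕ → ℕ → Set where
  upper : ∀ {d t} → parity d ≡ 0ℙ → d < 2 + j → t + d ≡ 4 + 2 * j →
          Rank j d (4 * t)
  lower : ∀ {d} → parity d ≡ 1ℙ → d < 2 + j → Rank j d (4 * d)
  last  : Rank j (2 + j) (9 + 4 * j)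

-- With N = 2 + j these are 8N - 4, 8N + 6, 12N + 1 and 12N + 2. The shifted last rank 4N + 1 gives
-- the edge from N - 1 to N the sum 8N + 5 or 8N - 3, so the first window must extend past 8N + 4;
-- the second contains one integer.
cycle-thresholds : ℕ → Fin 4 → ℕ
cycle-thresholds j 0F = 12 + 8 * j
cycle-thresholds j 1F = 22 + 8 * j
cycle-thresholds j 2F = 25 + 12 * j
cycle-thresholds j 3F = 26 + 12 * j

rank-exists : ∀ j d → d < 3 + j → ∃[ r ] Rank j d r
rank-exists j d (s≤s d≤N) with d ℕ.≟ 2 + j
... | yes refl = _ , last
... | no d≢N with parity d in par
...   | 0ℙ = _ , upper par (ℕ.≤∧≢⇒< d≤N d≢N)
               (ℕ.m∸n+n≡m (ℕ.≤-trans d≤N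
                 (ℕ.+-mono-≤ {2} {4} (s≤s (s≤s z≤n)) (ℕ.m≤m+n j _))))
...   | 1ℙ = _ , lower par (ℕ.≤∧≢⇒< d≤N d≢N)

-- Explicit slack turns the inequalities below into equations for the ring solver.
≤-by : ∀ {m n} o → m + o ≡ n → m ≤ n
≤-by {m} o refl = ℕ.m≤m+n m o

InWindow : ℕ → ℕ → Set
InWindow j s =
  (cycle-thresholds j 0F ≤ s × ¬ cycle-thresholds j 1F ≤ s) ⊎
  (cycle-thresholds j 2F ≤ s × ¬ cycle-thresholds j 3F ≤ s)

in-lower : ∀ j {s} a b → 12 + 8 * j + a ≡ s → suc s + b ≡ 22 + 8 * j →
  InWindow j s
in-lower j a b p q = inj₁ (≤-by a p , ℕ.<⇒≱ (≤-by b q))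

below : ∀ j {s} a → suc s + a ≡ 12 + 8 * j → ¬ InWindow j s
below j a p (inj₁ (θ₀≤ , _)) = ℕ.<⇒≱ (≤-by a p) θ₀≤
below j {s} a p (inj₂ (θ₂≤ , _)) = ℕ.<⇒≱ (≤-by a p)
  (ℕ.≤-trans (ℕ.+-mono-≤ {12} {25} (ℕ.m≤m+n 12 13) (ℕ.*-monoˡ-≤ j (ℕ.m≤m+n 8 4))) θ₂≤)

between : ∀ j {s} a → 22 + 8 * j + a ≡ s → s ≢ 25 + 12 * j →
  ¬ InWindow j s
between j a p s≢ (inj₁ (_ , ¬θ₁≤)) = ¬θ₁≤ (≤-by a p)
between j a p s≢ (inj₂ (θ₂≤ , ¬θ₃≤)) =
  s≢ (ℕ.≤-antisym (ℕ.s≤s⁻¹ (ℕ.≰⇒> ¬θ₃≤)) θ₂≤)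

-- Parity is enough. Ranks other than the last are multiples of 4, so two of them never sum to the
-- value in the second window.
4∤25+12j : ∀ t j → 4 * t ≢ 25 + 12 * j
4∤25+12j t j eq = ℕ.even≢odd (2 * t) (12 + 6 * j)
  (trans (double t) (trans eq (halve-j j)))
  where
  double : ∀ t → 2 * (2 * t) ≡ 4 * t
  double = solve-∀
  halve-j : ∀ j → 25 + 12 * j ≡ suc (2 * (12 + 6 * j))
  halve-j = solve-∀

parity-alternates : ∀ d → parity d ≢ parity (suc d)
parity-alternates d eq =
  ℙ.p≢p⁻¹ (parity (suc d)) (trans (sym eq) (sym (ℙ.suc-homo-⁻¹ d)))

-- Expressing `t` through `d` and its gap `k` to N - 1 removes subtraction, so that `t` can be
-- substituted away.
upper-height : ∀ {j t} d k → d + k ≡ 1 + j → t + d ≡ 4 + 2 * j →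
  t ≡ 2 + d + 2 * k
upper-height {j} {t} d k d+k≡ t+d≡ = ℕ.+-cancelʳ-≡ d t (2 + d + 2 * k) (begin
  t + d             ≡⟨ t+d≡ ⟩
  4 + 2 * j         ≡⟨ ring j ⟩
  2 + 2 * (1 + j)   ≡⟨ cong (λ x → 2 + 2 * x) d+k≡ ⟨
  2 + 2 * (d + k)   ≡⟨ ring′ d k ⟩
  2 + d + 2 * k + d ∎)
  where
  open ≡-Reasoning
  ring : ∀ j → 4 + 2 * j ≡ 2 + 2 * (1 + j)
  ring = solve-∀
  ring′ : ∀ d k → 2 + 2 * (d + k) ≡ 2 + d + 2 * k + d
  ring′ = solve-∀

m+[2+n+o]≡2+m+n+o : ∀ m n o → m + (2 + n + o) ≡ 2 + m + n + o
m+[2+n+o]≡2+m+n+o = solve-∀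

consecutive-sum : ∀ {j d r s} → Rank j d r → Rank j (suc d) s → InWindow j (r + s)
consecutive-sum {d = d} (upper p _ _) (upper q _ _) =
  contradiction (trans p (sym q)) (parity-alternates d)
consecutive-sum {d = d} (lower p _) (lower q _) =
  contradiction (trans p (sym q)) (parity-alternates d)
consecutive-sum {d = d} (upper {t = t} _ _ t+d≡) (lower _ d+1<N)
  with ℕ.m≤n⇒∃[o]m+o≡n d+1<N
... | k , refl
  with refl ← upper-height d (suc k) (ℕ.+-suc d k) t+d≡ =
  in-lower (d + k) 8 1 (ring₁ d k) (ring₂ d k)
  where
  ring₁ : ∀ d k → 12 + 8 * (d + k) + 8 ≡
    4 * (2 + d + 2 * (1 + k)) + 4 * (1 + d)
  ring₁ = solve-∀
  ring₂ : ∀ d k → suc (4 * (2 + d + 2 * (1 + k)) + 4 * (1 + d)) + 1 ≡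
    22 + 8 * (d + k)
  ring₂ = solve-∀
consecutive-sum {d = d} (lower _ _) (upper {t = t} _ d+1<N t+d+1≡)
  with ℕ.m≤n⇒∃[o]m+o≡n d+1<N
... | k , refl
  with refl ← upper-height (suc d) k refl t+d+1≡ =
  in-lower (d + k) 0 9 (ring₁ d k) (ring₂ d k)
  where
  ring₁ : ∀ d k → 12 + 8 * (d + k) + 0 ≡
    4 * d + 4 * (3 + d + 2 * k)
  ring₁ = solve-∀
  ring₂ : ∀ d k → suc (4 * d + 4 * (3 + d + 2 * k)) + 9 ≡
    22 + 8 * (d + k)
  ring₂ = solve-∀
consecutive-sum {j} (upper {t = t} _ _ t+d≡) last
  with refl ← upper-height (suc j) 0 (ℕ.+-identityʳ (suc j)) t+d≡ =
  in-lower j 9 0 (ring₁ j) (ring₂ j)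
  where
  ring₁ : ∀ j → 12 + 8 * j + 9 ≡ 4 * (3 + j + 0) + (9 + 4 * j)
  ring₁ = solve-∀
  ring₂ : ∀ j → suc (4 * (3 + j + 0) + (9 + 4 * j)) + 0 ≡ 22 + 8 * j
  ring₂ = solve-∀
consecutive-sum {j} (lower _ _) last = in-lower j 1 8 (ring₁ j) (ring₂ j)
  where
  ring₁ : ∀ j → 12 + 8 * j + 1 ≡ 4 * (1 + j) + (9 + 4 * j)
  ring₁ = solve-∀
  ring₂ : ∀ j → suc (4 * (1 + j) + (9 + 4 * j)) + 8 ≡ 22 + 8 * j
  ring₂ = solve-∀
consecutive-sum last (upper _ 1+N<N _) = contradiction 1+N<N (ℕ.<⇒≯ (ℕ.n<1+n _))
consecutive-sum last (lower _ 1+N<N) = contradiction 1+N<N (ℕ.<⇒≯ (ℕ.n<1+n _))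

closing-sum : ∀ {j r s} → Rank j 0 r → Rank j (2 + j) s → InWindow j (r + s)
closing-sum r (upper _ N<N _) = contradiction refl (ℕ.<⇒≢ N<N)
closing-sum r (lower _ N<N) = contradiction refl (ℕ.<⇒≢ N<N)
closing-sum {j} (upper {t = t} _ _ t+0≡) last
  with refl ← trans (sym (ℕ.+-identityʳ t)) t+0≡ =
  inj₂ (ℕ.≤-reflexive (sym (ring j)) , ℕ.<⇒≱ (ℕ.≤-reflexive (cong suc (ring j))))
  where
  ring : ∀ j → 4 * (4 + 2 * j) + (9 + 4 * j) ≡ 25 + 12 * j
  ring = solve-∀

-- The earlier vertex decides the side. A lower rank there keeps the sum below 8N - 4; an upper rank
-- pushes it to at least 8N + 6, where it misses 12N + 1 by parity or, next to the last rank, falls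
-- short by 4 times the index of the earlier vertex, which is 0 only for the closing edge.
distant-sum : ∀ {j d e r s} → Rank j d r → Rank j e s → 2 + d ≤ e →
  ¬ (e ≡ 2 + j × d ≡ 0) → ¬ InWindow j (r + s)
distant-sum {d = d} (upper {t = t} _ _ t+d≡) (upper {t = t′} _ e<N t′+e≡) d+2≤e _
  with ℕ.m≤n⇒∃[o]m+o≡n d+2≤e
... | i , refl with ℕ.m≤n⇒∃[o]m+o≡n e<N
... | k , refl
  with refl ← upper-height d (2 + i + k) (m+[2+n+o]≡2+m+n+o d i k) t+d≡
  with refl ← upper-height (2 + d + i) k refl t′+e≡ =
  between (1 + d + i + k) (10 + 4 * i + 8 * k) (ring₁ d i k)
    (4∤25+12j (t + t′) (1 + d + i + k) ∘ trans (ℕ.*-distribˡ-+ 4 t t′))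
  where
  ring₁ : ∀ d i k → 22 + 8 * (1 + d + i + k) + (10 + 4 * i + 8 * k) ≡
    4 * (2 + d + 2 * (2 + i + k)) + 4 * (4 + d + i + 2 * k)
  ring₁ = solve-∀
distant-sum {d = d} (upper {t = t} _ _ t+d≡) (lower {e} _ e<N) d+2≤e _
  with ℕ.m≤n⇒∃[o]m+o≡n d+2≤e
... | i , refl with ℕ.m≤n⇒∃[o]m+o≡n e<N
... | k , refl
  with refl ← upper-height d (2 + i + k) (m+[2+n+o]≡2+m+n+o d i k) t+d≡ =
  between (1 + d + i + k) (2 + 4 * i) (ring₁ d i k)
    (4∤25+12j (t + e) (1 + d + i + k) ∘ trans (ℕ.*-distribˡ-+ 4 t e))
  where
  ring₁ : ∀ d i k → 22 + 8 * (1 + d + i + k) + (2 + 4 * i) ≡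
    4 * (2 + d + 2 * (2 + i + k)) + 4 * (2 + d + i)
  ring₁ = solve-∀
distant-sum {d = d} (lower _ _) (upper {t = t′} _ e<N t′+e≡) d+2≤e _
  with ℕ.m≤n⇒∃[o]m+o≡n d+2≤e
... | i , refl with ℕ.m≤n⇒∃[o]m+o≡n e<N
... | k , refl
  with refl ← upper-height (2 + d + i) k refl t′+e≡ =
  below (1 + d + i + k) (3 + 4 * i) (ring₁ d i k)
  where
  ring₁ : ∀ d i k →
    suc (4 * d + 4 * (4 + d + i + 2 * k)) + (3 + 4 * i) ≡
    12 + 8 * (1 + d + i + k)
  ring₁ = solve-∀
distant-sum {d = d} (lower _ _) (lower _ e<N) d+2≤e _
  with ℕ.m≤n⇒∃[o]m+o≡n d+2≤e
... | i , refl with ℕ.m≤n⇒∃[o]m+o≡n e<N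
... | k , refl =
  below (1 + d + i + k) (11 + 4 * i + 8 * k) (ring d i k)
  where
  ring : ∀ d i k →
    suc (4 * d + 4 * (2 + d + i)) + (11 + 4 * i + 8 * k) ≡
    12 + 8 * (1 + d + i + k)
  ring = solve-∀
distant-sum {d = zero} (upper _ _ _) last _ ¬closing = contradiction (refl , refl) ¬closing
distant-sum {d = suc d} (upper {t = t} _ _ t+d≡) last d+2≤e _
  with ℕ.m≤n⇒∃[o]m+o≡n d+2≤e
... | i , refl
  with refl ← upper-height (suc d) (suc i) (cong suc (ℕ.+-suc d i)) t+d≡ =
  between (1 + d + i) (3 + 4 * i) (ring₁ d i)
    (ℕ.<⇒≢ (≤-by (3 + 4 * d) (ring₂ d i)))
  where
  ring₁ : ∀ d i → 22 + 8 * (1 + d + i) + (3 + 4 * i) ≡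
    4 * (3 + d + 2 * (1 + i)) + (9 + 4 * (1 + d + i))
  ring₁ = solve-∀
  ring₂ : ∀ d i → suc (4 * (3 + d + 2 * (1 + i)) + (9 + 4 * (1 + d + i))) +
    (3 + 4 * d) ≡ 25 + 12 * (1 + d + i)
  ring₂ = solve-∀
distant-sum {d = d} (lower _ _) last d+2≤e _
  with ℕ.m≤n⇒∃[o]m+o≡n d+2≤e
... | i , refl = below (d + i) (2 + 4 * i) (ring d i)
  where
  ring : ∀ d i → suc (4 * d + (9 + 4 * (d + i))) + (2 + 4 * i) ≡
    12 + 8 * (d + i)
  ring = solve-∀
distant-sum last (upper _ e<N _) d+2≤e _ =
  contradiction e<N (ℕ.≤⇒≯ (ℕ.≤-trans (ℕ.m≤n+m _ 2) d+2≤e))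
distant-sum last (lower _ e<N) d+2≤e _ =
  contradiction e<N (ℕ.≤⇒≯ (ℕ.≤-trans (ℕ.m≤n+m _ 2) d+2≤e))
distant-sum last last d+2≤e _ = contradiction d+2≤e (ℕ.<⇒≱ (ℕ.n≤1+n _))

cycle-threshold₄ : ∀ {n} (3≤n : 3 ≤ n) → IsThresholdGraph (cycle n 3≤n) 4
cycle-threshold₄ {suc (suc (suc j))} 3≤n@(s≤s (s≤s (s≤s _))) =
  natural-threshold (cycle n 3≤n) θ r θ-increasing
    λ u v u≢v → mk⇔ (edge⇒odd u v) (odd⇒edge u v u≢v)
  where
  n = 3 + j
  open Graph (cycle n 3≤n)

  θ : Fin 4 → ℕ
  θ = cycle-thresholds j

  r : Fin n → ℕ
  r u = proj₁ (rank-exists j (toℕ u) (Fin.toℕ<n u))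

  rank : ∀ u → Rank j (toℕ u) (r u)
  rank u = proj₂ (rank-exists j (toℕ u) (Fin.toℕ<n u))

  θ₀<θ₁ : θ 0F < θ 1F
  θ₀<θ₁ = ≤-by 9 (ring j)
    where
    ring : ∀ j → suc (12 + 8 * j) + 9 ≡ 22 + 8 * j
    ring = solve-∀

  θ₁<θ₂ : θ 1F < θ 2F
  θ₁<θ₂ = ℕ.+-mono-≤ {23} {25} (ℕ.m≤m+n 23 2) (ℕ.*-monoˡ-≤ j (ℕ.m≤m+n 8 4))

  θ₂<θ₃ : θ 2F < θ 3F
  θ₂<θ₃ = ℕ.≤-refl

  θ-increasing : ∀ i k → i Fin.< k → θ i < θ k
  θ-increasing 0F 1F _ = θ₀<θ₁
  θ-increasing 0F 2F _ = ℕ.<-trans θ₀<θ₁ θ₁<θ₂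
  θ-increasing 0F 3F _ = ℕ.<-trans θ₀<θ₁ (ℕ.<-trans θ₁<θ₂ θ₂<θ₃)
  θ-increasing 1F 2F _ = θ₁<θ₂
  θ-increasing 1F 3F _ = ℕ.<-trans θ₁<θ₂ θ₂<θ₃
  θ-increasing 2F 3F _ = θ₂<θ₃
  θ-increasing 0F 0F ()
  θ-increasing 1F 0F ()
  θ-increasing 1F 1F (s≤s ())
  θ-increasing 2F 0F ()
  θ-increasing 2F 1F (s≤s ())
  θ-increasing 2F 2F (s≤s (s≤s ()))
  θ-increasing 3F 0F ()
  θ-increasing 3F 1F (s≤s ())
  θ-increasing 3F 2F (s≤s (s≤s ()))
  θ-increasing 3F 3F (s≤s (s≤s (s≤s ())))

  Odd : Rel (Fin n) 0ℓ
  Odd u v = OddCount (reached? (cycle n 3≤n) θ r u v)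

  next⇒window : ∀ u v → Next u v → InWindow j (r u + r v)
  next⇒window u v (inj₁ 1+u≡v) =
    consecutive-sum (rank u) (subst (λ e → Rank j e (r v)) (sym 1+u≡v) (rank v))
  next⇒window u v (inj₂ (1+u≡n , v≡0)) = subst (InWindow j) (ℕ.+-comm (r v) (r u))
    (closing-sum (subst (λ e → Rank j e (r v)) v≡0 (rank v))
      (subst (λ e → Rank j e (r u)) (ℕ.suc-injective 1+u≡n) (rank u)))

  edge⇒window : ∀ u v → Adj u v → InWindow j (r u + r v)
  edge⇒window u v (inj₁ uv) = next⇒window u v uv
  edge⇒window u v (inj₂ vu) =
    subst (InWindow j) (ℕ.+-comm (r v) (r u)) (next⇒window v u vu)

  <-nonedge⇒¬window : ∀ u v → toℕ u < toℕ v → ¬ Adj u v → ¬ InWindow j (r u + r v)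
  <-nonedge⇒¬window u v u<v ¬uv = distant-sum (rank u) (rank v)
    (ℕ.≤∧≢⇒< u<v (¬uv ∘ inj₁ ∘ inj₁))
    λ (v≡N , u≡0) → ¬uv (inj₂ (inj₂ (cong suc v≡N , u≡0)))

  nonedge⇒¬window : ∀ u v → u ≢ v → ¬ Adj u v → ¬ InWindow j (r u + r v)
  nonedge⇒¬window u v u≢v ¬uv with ℕ.<-cmp (toℕ u) (toℕ v)
  ... | tri< u<v _ _ = <-nonedge⇒¬window u v u<v ¬uv
  ... | tri≈ _ u≡v _ = contradiction (Fin.toℕ-injective u≡v) u≢v
  ... | tri> _ _ v<u = <-nonedge⇒¬window v u v<u (¬uv ∘ swap) ∘
    subst (InWindow j) (ℕ.+-comm (r u) (r v))

  weaken : ∀ {l m s} → l < m → m ≤ s → l ≤ s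
  weaken l<m = ℕ.≤-trans (ℕ.<⇒≤ l<m)

  edge⇒odd : ∀ u v → Adj u v → Odd u v
  edge⇒odd u v uv = odd-count₄⇐ (weaken θ₀<θ₁) (weaken θ₁<θ₂) (weaken θ₂<θ₃)
    (reached? (cycle n 3≤n) θ r u v) (edge⇒window u v uv)

  odd⇒edge : ∀ u v → u ≢ v → Odd u v → Adj u v
  odd⇒edge u v u≢v odd with Adj? u v
  ... | yes uv = uv
  ... | no ¬uv = contradiction
    (odd-count₄⇒ (weaken θ₀<θ₁) (weaken θ₁<θ₂) (weaken θ₂<θ₃)
      (reached? (cycle n 3≤n) θ r u v) odd)
    (nonedge⇒¬window u v u≢v ¬uv)

theorem1 : (n : ℕ) (3≤n : 3 ≤ n) →
    (n ≡ 3 → ThresholdNumber (cycle n 3≤n) 1) ×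
    (n ≡ 4 → ThresholdNumber (cycle n 3≤n) 2) ×
    (5 ≤ n → ThresholdNumber (cycle n 3≤n) 4)
theorem1 n 3≤n = Θ≡1 , Θ≡2 , Θ≡4
  where
  Θ≡1 : n ≡ 3 → ThresholdNumber (cycle n 3≤n) 1
  Θ≡1 refl = s≤s z≤n , cycle₃-threshold 3≤n , λ _ 1≤j _ → 1≤j

  Θ≡2 : n ≡ 4 → ThresholdNumber (cycle n 3≤n) 2
  Θ≡2 refl = s≤s z≤n , cycle₄-threshold 3≤n , λ
    { 1 _ t → contradiction t (cycle₄-¬threshold₁ 3≤n)
    ; (suc (suc _)) _ _ → s≤s (s≤s z≤n)
    }

  Θ≡4 : 5 ≤ n → ThresholdNumber (cycle n 3≤n) 4
  Θ≡4 5≤n = s≤s z≤n , cycle-threshold₄ 3≤n , λ j 1≤j t →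
    ℕ.≰⇒> λ j≤3 → ¬levels-cycle 3≤n 5≤n (threshold⇒levels (cycle n 3≤n) 1≤j j≤3 t)
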